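{- Let $G$ be a finite simple plane graph (a planar graph with a fixed embedding in the plane) having at least two faces, and let $g(G)$ denote its Grinberg number. Then every closed, spanning walk on $G$ has at least $g(G)/2$ repeats of vertices; that is, if for each vertex $v$ of $G$ we let $m_v$ be the number of times $v$ occurs in the walk minus one, then $\sum_{v \in V(G)} m_v \ge \tfrac{1}{2} g(G)$.
   Context: Let the faces of the plane graph $G$ (including the unbounded one) be $F_1,\dots,F_N$, and let $|F|$ denote the length of a face $F$, i.e. the number of edges on its boundary. The Grinberg set $\mathscr{G}(G)$ is the set of all numbers $\left|\sum_{i=1}^N \varepsilon_i(|F_i|-2)\right|$ with $(\varepsilon_1,\dots,\varepsilon_N)\in\{ -1,+1\}^N$, excluding the two sign vectors in which all components are equal. The Grinberg number is $g(G)=\min \mathscr{G}(G)$. A closed, spanning walk is a closed walk $v_{1},v_{2},\dots,v_{k},v_{k+1}=v_{1}$ (consecutive vertices adjacent) in which every vertex of $G$ occurs; the occurrences of a vertex are counted among $v_1,\dots,v_k$ (the final return to the start vertex is not counted separately). A vertex occurring exactly once contributes $0$ repeats. -}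

module Defs where

open import Data.Nat using (ℕ; zero; suc; _+_; _∸_; _⊓_; _<ᵇ_)
open import Data.Bool using (Bool; true; false; not; _∧_; if_then_else_)
open import Data.Fin using (Fin; toℕ)
import Data.Fin as Fin
open import Data.List using (List; []; _∷_; _++_; [_]; map; length; filterᵇ; upTo; allFin; concatMap; foldr)
open import Data.Bool.ListAction using (any)
open import Data.Nat.ListAction using (sum)
open import Data.Integer as ℤ using (ℤ; +_; _-_; -_; ∣_∣)
open import Data.Product using (∃; _×_)
open import Data.List.Relation.Unary.Linked using (Linked)
open import Relation.Binary.PropositionalEquality using (_≡_; _≢_)
open import Relation.Nullary.Decidable using (⌊_⌋)

iter : {A : Set} → (A → A) → ℕ → A → A
iter f zero x = x
iter f (suc k) x = f (iter f k x)

inOrbit : {D : ℕ} → (Fin D → Fin D) → Fin D → Fin D → Bool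
inOrbit {D} φ d d' = any (λ k → ⌊ iter φ k d Fin.≟ d' ⌋) (upTo D)

orbitSize : {D : ℕ} → (Fin D → Fin D) → Fin D → ℕ
orbitSize {D} φ d = length (filterᵇ (inOrbit φ d) (allFin D))

isOrbitRep : {D : ℕ} → (Fin D → Fin D) → Fin D → Bool
isOrbitRep {D} φ d = not (any (λ k → toℕ (iter φ k d) <ᵇ toℕ d) (upTo D))

orbitSizes : {D : ℕ} → (Fin D → Fin D) → List ℕ
orbitSizes {D} φ = map (orbitSize φ) (filterᵇ (isOrbitRep φ) (allFin D))

data MapReach {D : ℕ} (σ α : Fin D → Fin D) : Fin D → Fin D → Set where
  here  : ∀ {d} → MapReach σ α d d
  stepσ : ∀ {d d'} → MapReach σ α (σ d) d' → MapReach σ α d d'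
  stepα : ∀ {d d'} → MapReach σ α (α d) d' → MapReach σ α d d'

-- A finite simple connected plane graph, encoded (as usual) by a
-- combinatorial map of genus 0 (rotation system + Euler's formula).
-- Darts: Fin (nE + nE) (two per edge); α: the other half of the edge;
-- σ: rotation around a vertex; faces: orbits of φ = σ ∘ α, and the
-- length of a face is the length of its boundary walk (= orbit size).

record PlaneGraph : Set where
  field
    n          : ℕ
    nE         : ℕ
    vert       : Fin (nE + nE) → Fin n
    α          : Fin (nE + nE) → Fin (nE + nE)
    σ          : Fin (nE + nE) → Fin (nE + nE)
    σ⁻         : Fin (nE + nE) → Fin (nE + nE)
    α-invol    : ∀ d → α (α d) ≡ d
    α-nofix    : ∀ d → α d ≢ d
    σ-σ⁻       : ∀ d → σ (σ⁻ d) ≡ d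
    σ⁻-σ       : ∀ d → σ⁻ (σ d) ≡ d
    vert-σ     : ∀ d → vert (σ d) ≡ vert d
    vert-orbit : ∀ d d' → vert d ≡ vert d' → ∃ λ k → iter σ k d ≡ d'
    vert-surj  : ∀ v → ∃ λ d → vert d ≡ v
    noLoop     : ∀ d → vert (α d) ≢ vert d
    noMulti    : ∀ d d' → vert d ≡ vert d' → vert (α d) ≡ vert (α d') → d ≡ d'
    connected  : ∀ d d' → MapReach σ α d d'
    euler      : n + length (orbitSizes (λ d → σ (α d))) ≡ 2 + nE

  faceLengths : List ℕ
  faceLengths = orbitSizes (λ d → σ (α d))

  numFaces : ℕ
  numFaces = length faceLengths

  Adj : Fin n → Fin n → Set
  Adj u v = ∃ λ d → vert d ≡ u × vert (α d) ≡ v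

  IsClosedWalk : Fin n → List (Fin n) → Set
  IsClosedWalk v vs = Linked Adj (v ∷ vs ++ [ v ])

  repeats : List (Fin n) → ℕ
  repeats w = sum (map (λ u → length (filterᵇ (λ x → ⌊ u Fin.≟ x ⌋) w) ∸ 1) (allFin n))

open PlaneGraph public

signVecs : ℕ → List (List Bool)
signVecs zero = [ [] ]
signVecs (suc N) = concatMap (λ v → (true ∷ v) ∷ (false ∷ v) ∷ []) (signVecs N)

signedSum : List Bool → List ℤ → ℤ
signedSum (e ∷ es) (x ∷ xs) = (if e then x else - x) ℤ.+ signedSum es xs
signedSum _ _ = + 0

nonConstant : List Bool → Bool
nonConstant es = any (λ e → e) es ∧ any not es

grinbergSet : List ℕ → List ℕ
grinbergSet ls =
  map (λ es → ∣ signedSum es (map (λ l → + l - + 2) ls) ∣)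
      (filterᵇ nonConstant (signVecs (length ls)))

minList : List ℕ → ℕ
minList [] = 0
minList (x ∷ xs) = foldr _⊓_ x xs

grinbergNumber : List ℕ → ℕ
grinbergNumber ls = minList (grinbergSet ls)

{-# OPTIONS --safe #-}
module Submission where

-- The edges along which the walk first enters its vertices form a spanning tree T. An even edge
-- set inside a tree is empty (peel off leaves), so no set of faces other than none or all is
-- bounded by tree edges only; hence the edges outside T connect all faces, and by Euler's formula
-- they form a spanning tree T* of the dual graph. Colour the faces along T* so that the colour
-- changes exactly across edges walked an odd number of times; this then also holds across the
-- edges of T, since the edges where it fails form an even set inside T.
--
-- Let a colour class consist of E ≥ 1 faces with A darts on their boundaries, and let k be the
-- length of the walk. A tree edge has at most as many sides in the class as it has traversals, and
-- an edge of T* exceeds this by at most 2, which only happens for the at most E - 1 edges of T* with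
-- both sides in the class. So A ≤ k + 2(E - 1), and Euler's formula turns the bounds for the two
-- classes into the claim. If one class is empty, all edges are walked an even number of times,
-- k ≥ 2(n - 1), and any nonconstant choice of signs satisfies the same bounds.

open import Defs
  hiding (n; nE; vert; α; σ; σ⁻; α-invol; α-nofix; σ-σ⁻; σ⁻-σ;
          vert-σ; vert-orbit; vert-surj; noLoop; noMulti; connected; euler;
          faceLengths; numFaces; Adj; IsClosedWalk; repeats)
open import Data.Nat using (ℕ; zero; suc; pred; _+_; _∸_; _*_; _≤_; _<_; _⊓_; _<ᵇ_; z≤n; s≤s)
open import Data.Nat.Properties
open import Data.Nat.DivMod using (_/_; _%_; m≡m%n+[m/n]*n; m%n<n)
open import Data.Nat.Induction using (<-wellFounded; Acc; acc)
open import Data.Nat.ListAction using (sum)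
open import Data.Nat.ListAction.Properties using (sum-↭)
open import Data.Nat.Tactic.RingSolver using (solve-∀)
open import Data.Bool using (Bool; true; false; not; _∧_; _xor_; if_then_else_; T)
import Data.Bool.Properties as Bool
open import Data.Bool.ListAction using (any)
open import Data.Fin using (Fin; zero; suc; toℕ)
import Data.Fin as Fin
import Data.Fin.Properties as Fin
open import Data.Fin.Permutation using (Permutation′; permutation)
open import Data.Integer as ℤ using (ℤ; ∣_∣)
import Data.Integer.Properties as ℤ
import Data.Integer.Tactic.RingSolver as ℤ-Solver
open import Data.List using (List; []; _∷_; _++_; [_]; map; length; filterᵇ; upTo; allFin; lookup; foldr)
open import Data.List.Properties using (length-map; length-++; length-tabulate)
open import Data.List.Membership.Propositional using (_∈_; _∉_; lose; find)
open import Data.List.Membership.Propositional.Properties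
open import Data.List.Membership.Propositional.Properties.WithK using (unique∧set⇒bag)
open import Data.List.Relation.Binary.BagAndSetEquality using (∼bag⇒↭)
open import Data.List.Relation.Binary.Permutation.Propositional using (_↭_)
import Data.List.Relation.Binary.Permutation.Propositional.Properties as ↭
open import Data.List.Relation.Unary.All as All using (All; []; _∷_)
open import Data.List.Relation.Unary.All.Properties using (¬Any⇒All¬)
open import Data.List.Relation.Unary.Any using (here; there)
open import Data.List.Relation.Unary.Any using (any?)
import Data.List.Relation.Unary.Any.Properties as Any
open import Data.List.Relation.Unary.AllPairs using ([]; _∷_)
open import Data.List.Relation.Unary.Linked using (Linked; _∷_)
open import Data.List.Relation.Unary.Unique.Propositional using (Unique)
import Data.List.Relation.Unary.Unique.Propositional.Properties as Unique
open import Data.Product using (∃; _×_; _,_; proj₁; proj₂)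
open import Data.Sum using (_⊎_; inj₁; inj₂)
open import Function using (_∘_; id; mk⇔; Equivalence)
open import Relation.Binary using (DecidableEquality)
open import Relation.Binary.PropositionalEquality hiding ([_])
open import Relation.Nullary using (¬_; yes; no; contradiction)
open import Relation.Nullary.Decidable using (⌊_⌋; ¬?; _×-dec_; toWitness; fromWitness)
open import Algebra.Bundles using (CommutativeRing)

-- Sums over lists and counting in finite sets.

bit : Bool → ℕ
bit true  = 1
bit false = 0

∑ : {A : Set} → List A → (A → ℕ) → ℕ
∑ xs f = sum (map f xs)

module _ {A : Set} where

  ∑-cong : ∀ {f g : A → ℕ} xs → (∀ {x} → x ∈ xs → f x ≡ g x) → ∑ xs f ≡ ∑ xs g
  ∑-cong []       eq = refl
  ∑-cong (x ∷ xs) eq = cong₂ _+_ (eq (here refl)) (∑-cong xs (eq ∘ there))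

  ∑-mono : ∀ {f g : A → ℕ} xs → (∀ {x} → x ∈ xs → f x ≤ g x) → ∑ xs f ≤ ∑ xs g
  ∑-mono []       le = z≤n
  ∑-mono (x ∷ xs) le = +-mono-≤ (le (here refl)) (∑-mono xs (le ∘ there))

  ∑-distrib-+ : ∀ (f g : A → ℕ) xs → ∑ xs (λ x → f x + g x) ≡ ∑ xs f + ∑ xs g
  ∑-distrib-+ f g []       = refl
  ∑-distrib-+ f g (x ∷ xs) = trans (cong ((f x + g x) +_) (∑-distrib-+ f g xs))
                                   (interchange (f x) (g x) (∑ xs f) (∑ xs g))
    where
    interchange : ∀ a b c d → a + b + (c + d) ≡ a + c + (b + d)
    interchange = solve-∀

  ∑-const : ∀ c (xs : List A) → ∑ xs (λ _ → c) ≡ length xs * c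
  ∑-const c []       = refl
  ∑-const c (x ∷ xs) = cong (c +_) (∑-const c xs)

  ∑-zero : ∀ {f : A → ℕ} xs → (∀ {x} → x ∈ xs → f x ≡ 0) → ∑ xs f ≡ 0
  ∑-zero []       eq = refl
  ∑-zero (x ∷ xs) eq = cong₂ _+_ (eq (here refl)) (∑-zero xs (eq ∘ there))

  ∑-*ˡ : ∀ c (f : A → ℕ) xs → ∑ xs (λ x → c * f x) ≡ c * ∑ xs f
  ∑-*ˡ c f []       = sym (*-zeroʳ c)
  ∑-*ˡ c f (x ∷ xs) = trans (cong ((c * f x) +_) (∑-*ˡ c f xs)) (sym (*-distribˡ-+ c (f x) (∑ xs f)))

  ∑-single : ∀ {f : A → ℕ} {xs x} → Unique xs → x ∈ xs → (∀ y → y ≢ x → f y ≡ 0) → ∑ xs f ≡ f x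
  ∑-single {f} {_ ∷ xs} {x} (x∉ ∷ u) (here refl) z =
    trans (cong (f x +_) (∑-zero xs (λ y∈ → z _ (λ y≡x → All.lookup x∉ y∈ (sym y≡x)))))
          (+-identityʳ (f x))
  ∑-single {f} {y ∷ xs} (y∉ ∷ u) (there x∈) z =
    cong₂ _+_ (z y (All.lookup y∉ x∈)) (∑-single u x∈ z)

  ∑-↭ : ∀ (f : A → ℕ) {xs ys} → xs ↭ ys → ∑ xs f ≡ ∑ ys f
  ∑-↭ f = sum-↭ ∘ ↭.map⁺ f

  ∑-++ : ∀ (f : A → ℕ) xs {ys} → ∑ (xs ++ ys) f ≡ ∑ xs f + ∑ ys f
  ∑-++ f []       = refl
  ∑-++ f (x ∷ xs) {ys} = trans (cong (f x +_) (∑-++ f xs)) (sym (+-assoc (f x) (∑ xs f) (∑ ys f)))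

  length-filterᵇ : ∀ (p : A → Bool) xs → length (filterᵇ p xs) ≡ ∑ xs (bit ∘ p)
  length-filterᵇ p []       = refl
  length-filterᵇ p (x ∷ xs) with p x
  ... | true  = cong suc (length-filterᵇ p xs)
  ... | false = length-filterᵇ p xs

  unique∧set⇒↭ : ∀ {xs ys : List A} → Unique xs → Unique ys →
                 (∀ {x} → x ∈ xs → x ∈ ys) → (∀ {x} → x ∈ ys → x ∈ xs) → xs ↭ ys
  unique∧set⇒↭ u v to from = ∼bag⇒↭ (unique∧set⇒bag u v (mk⇔ to from))

  unique-lookup : ∀ {xs : List A} → Unique xs → ∀ {i j} → i Fin.< j → lookup xs i ≢ lookup xs j
  unique-lookup (x∉ ∷ u) {zero}  {suc j} _         = All.lookup x∉ (∈-lookup j)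
  unique-lookup (x∉ ∷ u) {suc i} {suc j} (s≤s i<j) = unique-lookup u i<j

∑-swap : ∀ {A B : Set} (f : A → B → ℕ) xs ys →
         ∑ xs (λ x → ∑ ys (f x)) ≡ ∑ ys (λ y → ∑ xs (λ x → f x y))
∑-swap f []       ys = sym (∑-zero ys (λ _ → refl))
∑-swap f (x ∷ xs) ys = trans (cong (∑ ys (f x) +_) (∑-swap f xs ys))
                             (sym (∑-distrib-+ (f x) (λ y → ∑ xs (λ x → f x y)) ys))

module _ {D : ℕ} where

  unique⇒length≤ : ∀ {xs : List (Fin D)} → Unique xs → length xs ≤ D
  unique⇒length≤ {xs} u with length xs ≤? D
  ... | yes le = le
  ... | no  gt with i , j , i<j , eq ← Fin.pigeonhole (≰⇒> gt) (lookup xs) =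
    contradiction eq (unique-lookup u i<j)

  open import Data.List.Membership.DecPropositional (Fin._≟_ {D}) using (_∈?_)

  unique⇒full : ∀ {xs : List (Fin D)} → Unique xs → D ≤ length xs → ∀ d → d ∈ xs
  unique⇒full {xs} u le d with d ∈? xs
  ... | yes d∈ = d∈
  ... | no  d∉ = contradiction (unique⇒length≤ (¬Any⇒All¬ xs d∉ ∷ u)) (<⇒≱ (s≤s le))

  full⇒↭ : ∀ {xs : List (Fin D)} → Unique xs → (∀ d → d ∈ xs) → xs ↭ allFin D
  full⇒↭ u full = unique∧set⇒↭ u (Unique.allFin⁺ D) (λ _ → ∈-allFin _) (λ _ → full _)

  ∑-indicator : ∀ x → ∑ (allFin D) (λ y → bit ⌊ y Fin.≟ x ⌋) ≡ 1
  ∑-indicator x = trans (∑-single (Unique.allFin⁺ D) (∈-allFin x) off) on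
    where
    off : ∀ y → y ≢ x → bit ⌊ y Fin.≟ x ⌋ ≡ 0
    off y y≢x with y Fin.≟ x
    ... | yes y≡x = contradiction y≡x y≢x
    ... | no  _   = refl
    on : bit ⌊ x Fin.≟ x ⌋ ≡ 1
    on with x Fin.≟ x
    ... | yes _   = refl
    ... | no  x≢x = contradiction refl x≢x

  ∑-count : ∀ (xs : List (Fin D)) →
            ∑ (allFin D) (λ y → length (filterᵇ (λ x → ⌊ y Fin.≟ x ⌋) xs)) ≡ length xs
  ∑-count xs = begin
    ∑ (allFin D) (λ y → length (filterᵇ (λ x → ⌊ y Fin.≟ x ⌋) xs))
      ≡⟨ ∑-cong (allFin D) (λ {y} _ → length-filterᵇ (λ x → ⌊ y Fin.≟ x ⌋) xs) ⟩
    ∑ (allFin D) (λ y → ∑ xs (λ x → bit ⌊ y Fin.≟ x ⌋))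
      ≡⟨ ∑-swap (λ y x → bit ⌊ y Fin.≟ x ⌋) (allFin D) xs ⟩
    ∑ xs (λ x → ∑ (allFin D) (λ y → bit ⌊ y Fin.≟ x ⌋))
      ≡⟨ ∑-cong xs (λ {x} _ → ∑-indicator x) ⟩
    ∑ xs (λ _ → 1)
      ≡⟨ ∑-const 1 xs ⟩
    length xs * 1
      ≡⟨ *-identityʳ _ ⟩
    length xs ∎
    where open ≡-Reasoning

xor-false : ∀ {b c} → b xor c ≡ false → c ≡ b
xor-false {true}  {true}  _ = refl
xor-false {false} {false} _ = refl

T-iff : ∀ {b c} → (T b → T c) → (T c → T b) → b ≡ c
T-iff {true}  {true}  _ _ = refl
T-iff {true}  {false} f _ = contradiction _ f
T-iff {false} {true}  _ g = contradiction _ g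
T-iff {false} {false} _ _ = refl

T-not : ∀ {b} → T (not b) → ¬ T b
T-not {false} _ ()

not-T : ∀ {b} → ¬ T b → T (not b)
not-T {true}  f = f _
not-T {false} _ = _

-- Orbits of an injective self-map and their least elements.

module Orbits {D : ℕ} (φ : Fin D → Fin D) (φ-injective : ∀ {x y} → φ x ≡ φ y → x ≡ y) where

  Orbit : Fin D → Fin D → Set
  Orbit x y = ∃ λ k → iter φ k x ≡ y

  iter-+ : ∀ j k x → iter φ (j + k) x ≡ iter φ j (iter φ k x)
  iter-+ zero    k x = refl
  iter-+ (suc j) k x = cong φ (iter-+ j k x)

  iter-injective : ∀ k {x y} → iter φ k x ≡ iter φ k y → x ≡ y
  iter-injective zero    eq = eq
  iter-injective (suc k) eq = iter-injective k (φ-injective eq)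

  -- Two of the `D + 1` iterates from 0 to `D` steps coincide, and injectivity cancels the steps
  -- common to both.
  period : ∀ x → ∃ λ p → suc p ≤ D × iter φ (suc p) x ≡ x
  period x with i , j , i<j , eq ← Fin.pigeonhole (n<1+n D) (λ i → iter φ (toℕ i) x) =
    p , p<D , iter-injective (toℕ i) (begin
      iter φ (toℕ i) (iter φ (suc p) x) ≡⟨ iter-+ (toℕ i) (suc p) x ⟨
      iter φ (toℕ i + suc p) x          ≡⟨ cong (λ k → iter φ k x) i+p≡j ⟩
      iter φ (toℕ j) x                  ≡⟨ eq ⟨
      iter φ (toℕ i) x                  ∎)
    where
    open ≡-Reasoning
    p = toℕ j ∸ suc (toℕ i)
    i+p≡j : toℕ i + suc p ≡ toℕ j
    i+p≡j = trans (+-suc (toℕ i) p) (m+[n∸m]≡n i<j)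
    p<D : suc p ≤ D
    p<D = ≤-trans (subst (suc p ≤_) i+p≡j (m≤n+m (suc p) (toℕ i))) (Fin.toℕ≤pred[n] j)

  iter-periodic : ∀ {x p} m → iter φ p x ≡ x → iter φ (m * p) x ≡ x
  iter-periodic         zero    eq = refl
  iter-periodic {x} {p} (suc m) eq =
    trans (iter-+ p (m * p) x) (trans (cong (iter φ p) (iter-periodic m eq)) eq)

  -- Reducing `k` modulo a period brings it below `D`, the range that `inOrbit` and `isOrbitRep`
  -- search.
  Orbit-bounded : ∀ {x y} → Orbit x y → ∃ λ k → k < D × iter φ k x ≡ y
  Orbit-bounded {x} (k , refl) with p , p<D , eq ← period x =
    k % suc p , <-≤-trans (m%n<n k (suc p)) p<D , (begin
      iter φ (k % suc p) x
        ≡⟨ cong (iter φ (k % suc p)) (iter-periodic (k / suc p) eq) ⟨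
      iter φ (k % suc p) (iter φ (k / suc p * suc p) x)
        ≡⟨ iter-+ (k % suc p) _ x ⟨
      iter φ (k % suc p + k / suc p * suc p) x
        ≡⟨ cong (λ k → iter φ k x) (m≡m%n+[m/n]*n k (suc p)) ⟨
      iter φ k x ∎)
    where open ≡-Reasoning

  Orbit-trans : ∀ {x y z} → Orbit x y → Orbit y z → Orbit x z
  Orbit-trans {x} (j , refl) (k , refl) = k + j , iter-+ k j x

  Orbit-sym : ∀ {x y} → Orbit x y → Orbit y x
  -- The period is `suc p`, so `k * p` further steps complete `k` full turns.
  Orbit-sym {x} (k , refl) with p , _ , eq ← period x = k * p , (begin
    iter φ (k * p) (iter φ k x) ≡⟨ iter-+ (k * p) k x ⟨
    iter φ (k * p + k) x        ≡⟨ cong (λ m → iter φ m x) (trans (+-comm (k * p) k) (sym (*-suc k p))) ⟩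
    iter φ (k * suc p) x        ≡⟨ iter-periodic k eq ⟩
    x                           ∎)
    where open ≡-Reasoning

  inOrbit⇒Orbit : ∀ {x y} → T (inOrbit φ x y) → Orbit x y
  inOrbit⇒Orbit {x} {y} t with k , _ , eq ← find (Any.any⁻ (λ k → ⌊ iter φ k x Fin.≟ y ⌋) (upTo D) t) =
    k , toWitness eq

  Orbit⇒inOrbit : ∀ {x y} → Orbit x y → T (inOrbit φ x y)
  Orbit⇒inOrbit o with k , k<D , eq ← Orbit-bounded o =
    Any.any⁺ _ (lose (∈-upTo⁺ k<D) (fromWitness eq))

  Minimal : Fin D → Set
  Minimal x = ∀ {y} → Orbit x y → toℕ x ≤ toℕ y

  isOrbitRep⇒Minimal : ∀ {x} → T (isOrbitRep φ x) → Minimal x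
  isOrbitRep⇒Minimal t o with k , k<D , refl ← Orbit-bounded o =
    ≮⇒≥ (λ lt → T-not t (Any.any⁺ _ (lose (∈-upTo⁺ k<D) (<⇒<ᵇ lt))))

  Minimal⇒isOrbitRep : ∀ {x} → Minimal x → T (isOrbitRep φ x)
  Minimal⇒isOrbitRep {x} min = not-T λ t →
    let k , _ , lt = find (Any.any⁻ (λ k → toℕ (iter φ k x) <ᵇ toℕ x) (upTo D) t)
    in <⇒≱ (<ᵇ⇒< _ _ lt) (min (k , refl))

  -- While some iterate is smaller than the current element, move there; the descent ends at the
  -- least element of the orbit.
  representative : ∀ x → Acc _<_ (toℕ x) → ∃ λ r → Orbit x r × Minimal r
  representative x (acc rs) with Bool.T? (any (λ k → toℕ (iter φ k x) <ᵇ toℕ x) (upTo D))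
  ... | no  ¬t = x , (0 , refl) , isOrbitRep⇒Minimal (not-T ¬t)
  ... | yes t  with k , _ , lt ← find (Any.any⁻ (λ k → toℕ (iter φ k x) <ᵇ toℕ x) (upTo D) t)
               with r , o , min ← representative (iter φ k x) (rs (<ᵇ⇒< _ _ lt)) =
    r , Orbit-trans (k , refl) o , min

  -- In the plane graph this names the face of a dart. A face colouring is then a Boolean function
  -- on darts that is read only at such names.
  rep : Fin D → Fin D
  rep x = proj₁ (representative x (<-wellFounded (toℕ x)))

  Orbit-rep : ∀ x → Orbit x (rep x)
  Orbit-rep x = proj₁ (proj₂ (representative x (<-wellFounded (toℕ x))))

  rep-Minimal : ∀ x → Minimal (rep x)
  rep-Minimal x = proj₂ (proj₂ (representative x (<-wellFounded (toℕ x))))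

  Minimal-unique : ∀ {x y} → Orbit x y → Minimal x → Minimal y → x ≡ y
  Minimal-unique o min min′ = Fin.toℕ-injective (≤-antisym (min o) (min′ (Orbit-sym o)))

  rep-cong : ∀ {x y} → Orbit x y → rep x ≡ rep y
  rep-cong {x} {y} o = Minimal-unique
    (Orbit-trans (Orbit-sym (Orbit-rep x)) (Orbit-trans o (Orbit-rep y))) (rep-Minimal x) (rep-Minimal y)

  rep-step : ∀ x → rep (φ x) ≡ rep x
  rep-step x = sym (rep-cong (1 , refl))

  rep-fixed : ∀ {x} → Minimal x → rep x ≡ x
  rep-fixed {x} min = sym (Minimal-unique (Orbit-rep x) min (rep-Minimal x))

  reps : List (Fin D)
  reps = filterᵇ (isOrbitRep φ) (allFin D)

  reps-unique : Unique reps
  reps-unique = Unique.filter⁺ (λ x → Bool.T? (isOrbitRep φ x)) (Unique.allFin⁺ D)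

  rep∈reps : ∀ x → rep x ∈ reps
  rep∈reps x = ∈-filter⁺ (λ x → Bool.T? (isOrbitRep φ x)) (∈-allFin (rep x))
    (Minimal⇒isOrbitRep (rep-Minimal x))

  ∈reps⇒rep≡ : ∀ {x} → x ∈ reps → rep x ≡ x
  ∈reps⇒rep≡ {x} x∈ =
    rep-fixed (isOrbitRep⇒Minimal (proj₂
      (∈-filter⁻ (λ x → Bool.T? (isOrbitRep φ x)) {xs = allFin D} x∈)))

  inOrbit-rep : ∀ {x y} → x ∈ reps → inOrbit φ x y ≡ ⌊ x Fin.≟ rep y ⌋
  inOrbit-rep {x} {y} x∈ = T-iff
    (λ t → fromWitness (trans (sym (∈reps⇒rep≡ x∈)) (rep-cong (inOrbit⇒Orbit t))))
    (λ t → Orbit⇒inOrbit (subst (λ r → Orbit r y) (sym (toWitness t)) (Orbit-sym (Orbit-rep y))))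

  orbitSize≡∑ : ∀ {x} → x ∈ reps → orbitSize φ x ≡ ∑ (allFin D) (λ y → bit ⌊ x Fin.≟ rep y ⌋)
  orbitSize≡∑ {x} x∈ = trans (length-filterᵇ (inOrbit φ x) (allFin D))
    (∑-cong (allFin D) (λ _ → cong bit (inOrbit-rep x∈)))

  -- Double counting: each element lies in the orbit of exactly one representative. With `f` the
  -- indicator of a colour, the total length of the coloured faces becomes a number of darts.
  ∑-orbitSize : ∀ (f : Fin D → ℕ) → ∑ reps (λ x → f x * orbitSize φ x) ≡ ∑ (allFin D) (f ∘ rep)
  ∑-orbitSize f = begin
    ∑ reps (λ x → f x * orbitSize φ x)
      ≡⟨ ∑-cong reps (λ {x} x∈ → trans (cong (f x *_) (orbitSize≡∑ x∈))
                                       (sym (∑-*ˡ (f x) (λ y → bit ⌊ x Fin.≟ rep y ⌋) (allFin D)))) ⟩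
    ∑ reps (λ x → ∑ (allFin D) (λ y → f x * bit ⌊ x Fin.≟ rep y ⌋))
      ≡⟨ ∑-swap (λ x y → f x * bit ⌊ x Fin.≟ rep y ⌋) reps (allFin D) ⟩
    ∑ (allFin D) (λ y → ∑ reps (λ x → f x * bit ⌊ x Fin.≟ rep y ⌋))
      ≡⟨ ∑-cong (allFin D) (λ {y} _ → trans (∑-single reps-unique (rep∈reps y) (off y)) (on y)) ⟩
    ∑ (allFin D) (f ∘ rep) ∎
    where
    open ≡-Reasoning
    off : ∀ y x → x ≢ rep y → f x * bit ⌊ x Fin.≟ rep y ⌋ ≡ 0
    off y x x≢ with x Fin.≟ rep y
    ... | yes x≡ = contradiction x≡ x≢
    ... | no  _  = *-zeroʳ (f x)
    on : ∀ y → f (rep y) * bit ⌊ rep y Fin.≟ rep y ⌋ ≡ f (rep y)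
    on y with rep y Fin.≟ rep y
    ... | yes _  = *-identityʳ (f (rep y))
    ... | no  ne = contradiction refl ne

  2≤orbitSize : ∀ x → φ x ≢ x → 2 ≤ orbitSize φ x
  2≤orbitSize x ne = go (inOrbit-member 0 refl) (inOrbit-member 1 refl)
    where
    inOrbit-member : ∀ {y} k → iter φ k x ≡ y → y ∈ filterᵇ (inOrbit φ x) (allFin D)
    inOrbit-member k eq = ∈-filter⁺ (λ y → Bool.T? (inOrbit φ x y)) (∈-allFin _) (Orbit⇒inOrbit (k , eq))
    go : ∀ {xs : List (Fin D)} → x ∈ xs → φ x ∈ xs → 2 ≤ length xs
    go (here eq)               (here eq′)              = contradiction (trans eq′ (sym eq)) ne
    go {_ ∷ _ ∷ _} (here _)    (there _)               = s≤s (s≤s z≤n)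
    go {_ ∷ _ ∷ _} (there _)   _                       = s≤s (s≤s z≤n)

-- Trees grown leaf by leaf.

module Darts {A : Set} (α : A → A) (α-invol : ∀ d → α (α d) ≡ d) where

  -- Both halves of every edge of a list in which each edge is given by one half.
  darts : List A → List A
  darts []       = []
  darts (d ∷ ds) = d ∷ α d ∷ darts ds

  ∈⇒∈darts : ∀ {d ds} → d ∈ ds → d ∈ darts ds
  ∈⇒∈darts (here eq) = here eq
  ∈⇒∈darts (there p) = there (there (∈⇒∈darts p))

  darts-α : ∀ {d ds} → d ∈ darts ds → α d ∈ darts ds
  darts-α {ds = _ ∷ _} (here refl)         = there (here refl)
  darts-α {ds = d ∷ _} (there (here refl)) = here (α-invol d)
  darts-α {ds = _ ∷ _} (there (there p))   = there (there (darts-α p))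

  darts-α⁻ : ∀ {d ds} → α d ∈ darts ds → d ∈ darts ds
  darts-α⁻ {d} {ds} p = subst (_∈ darts ds) (α-invol d) (darts-α p)

  ∈darts⇒ : ∀ {d ds} → d ∈ darts ds → d ∈ ds ⊎ α d ∈ ds
  ∈darts⇒ {ds = _ ∷ _} (here eq)          = inj₁ (here eq)
  ∈darts⇒ {ds = d ∷ _} (there (here eq))  = inj₂ (here (trans (cong α eq) (α-invol d)))
  ∈darts⇒ {ds = _ ∷ _} (there (there p)) with ∈darts⇒ p
  ... | inj₁ q = inj₁ (there q)
  ... | inj₂ q = inj₂ (there q)

  darts-++ : ∀ ds {es} → darts (ds ++ es) ≡ darts ds ++ darts es
  darts-++ []       = refl
  darts-++ (d ∷ ds) = cong (λ l → d ∷ α d ∷ l) (darts-++ ds)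

  length-darts : ∀ ds → length (darts ds) ≡ 2 * length ds
  length-darts []       = refl
  length-darts (d ∷ ds) = trans (cong (2 +_) (length-darts ds)) (sym (*-suc 2 (length ds)))

  ∑-darts : ∀ f ds → ∑ (darts ds) f ≡ ∑ ds (λ d → f d + f (α d))
  ∑-darts f []       = refl
  ∑-darts f (d ∷ ds) = trans (cong (λ s → f d + (f (α d) + s)) (∑-darts f ds))
                             (sym (+-assoc (f d) (f (α d)) _))

  module Growth {V : Set} (end : A → V) where

    -- A tree with vertices vs and edges ds, grown by attaching one leaf after another.
    data Grown : List V → List A → Set where
      root : ∀ v → Grown [ v ] []
      grow : ∀ {vs ds} d → Grown vs ds → end d ∈ vs → end (α d) ∉ vs →
             Grown (end (α d) ∷ vs) (d ∷ ds)

    Grown-length : ∀ {vs ds} → Grown vs ds → length vs ≡ suc (length ds)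
    Grown-length (root v)       = refl
    Grown-length (grow d g _ _) = cong suc (Grown-length g)

    Grown-unique : ∀ {vs ds} → Grown vs ds → Unique vs
    Grown-unique (root v)             = [] ∷ []
    Grown-unique (grow {vs} d g _ d∉) = ¬Any⇒All¬ vs d∉ ∷ Grown-unique g

    Grown-ends : ∀ {vs ds d} → Grown vs ds → d ∈ darts ds → end d ∈ vs
    Grown-ends (grow d g d∈ _) (here refl)         = there d∈
    Grown-ends (grow d g _ _)  (there (here refl)) = here refl
    Grown-ends (grow d g _ _)  (there (there p))   = there (Grown-ends g p)

    Grown-darts-unique : ∀ {vs ds} → Grown vs ds → Unique (darts ds)
    Grown-darts-unique (root v) = []
    Grown-darts-unique (grow {vs} {ds} d g d∈ d∉) =
      (d≢αd ∷ ¬Any⇒All¬ (darts ds) (αd∉ ∘ darts-α)) ∷ ¬Any⇒All¬ (darts ds) αd∉ ∷ Grown-darts-unique g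
      where
      αd∉ : α d ∉ darts ds
      αd∉ p = d∉ (Grown-ends g p)
      d≢αd : d ≢ α d
      d≢αd eq = d∉ (subst (λ x → end x ∈ vs) eq d∈)

    -- Charge an edge with both ends in `P` to the leaf it attached. The vertex of `P` that joined
    -- first is never charged, whence the `pred`.
    Grown-inner-edges : ∀ {vs ds} → Grown vs ds → (P : V → Bool) →
      ∑ ds (λ d → bit (P (end d) ∧ P (end (α d)))) ≤ pred (∑ vs (bit ∘ P))
    Grown-inner-edges (root v) P = z≤n
    Grown-inner-edges (grow {vs} {ds} d g d∈ _) P with P (end d) in eq | P (end (α d))
    -- The new leaf raises the sum by one. The old tree already meets `P` in `end d`, so its sum is
    -- positive and `pred` can be undone.
    ... | true  | true  = ≤-trans (s≤s (Grown-inner-edges g P)) (≤-reflexive (suc-pred-∑ d∈))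
      where
      suc-pred-∑ : ∀ {vs} → end d ∈ vs → suc (pred (∑ vs (bit ∘ P))) ≡ ∑ vs (bit ∘ P)
      suc-pred-∑ (here refl) rewrite eq = refl
      suc-pred-∑ {v ∷ vs} (there p) with P v
      ... | true  = refl
      ... | false = suc-pred-∑ p
    ... | true  | false = Grown-inner-edges g P
    ... | false | true  = ≤-trans (Grown-inner-edges g P) pred[n]≤n
    ... | false | false = Grown-inner-edges g P

    -- Prescribed differences cannot conflict on a tree: its edge fixes the value at a new leaf, and
    -- as the leaf is new, the earlier differences stay as they are.
    Grown-potential : DecidableEquality V → ∀ {vs ds} → Grown vs ds → (p : A → Bool) →
      ∃ λ (c : V → Bool) → ∀ {d} → d ∈ ds → c (end d) xor c (end (α d)) ≡ p d
    Grown-potential _≟_ (root v) p = (λ _ → false) , λ ()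
    Grown-potential _≟_ (grow {vs} {ds} d g d∈ d∉) p with c , cp ← Grown-potential _≟_ g p =
      c′ , holds
      where
      c′ : V → Bool
      c′ v = if ⌊ v ≟ end (α d) ⌋ then c (end d) xor p d else c v
      old : ∀ {v} → v ∈ vs → c′ v ≡ c v
      old {v} v∈ with v ≟ end (α d)
      ... | yes refl = contradiction v∈ d∉
      ... | no  _    = refl
      new : c′ (end (α d)) ≡ c (end d) xor p d
      new with end (α d) ≟ end (α d)
      ... | yes _  = refl
      ... | no  ne = contradiction refl ne
      xor-cancel : ∀ a b → a xor (a xor b) ≡ b
      xor-cancel true  b = Bool.not-involutive b
      xor-cancel false b = refl
      holds : ∀ {e} → e ∈ d ∷ ds → c′ (end e) xor c′ (end (α e)) ≡ p e
      holds (here refl) rewrite old d∈ | new = xor-cancel (c (end d)) (p d)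
      holds (there e∈) rewrite old (Grown-ends g (∈⇒∈darts e∈))
                             | old (Grown-ends g (darts-α (∈⇒∈darts e∈))) = cp e∈

-- Sums modulo 2 and parity.

open import Algebra.Properties.CommutativeMonoid.Sum
  (CommutativeRing.+-commutativeMonoid Bool.xor-∧-commutativeRing)
  using (sum-permute; sum-cong-≗) renaming (sum to ⨁; ∑-distrib-+ to ⨁-distrib-xor)

⨁-zero : ∀ {n} {t : Fin n → Bool} → (∀ i → t i ≡ false) → ⨁ t ≡ false
⨁-zero {zero}  z = refl
⨁-zero {suc n} z = cong₂ _xor_ (z zero) (⨁-zero (z ∘ suc))

⨁-single : ∀ {n} (t : Fin n → Bool) i → (∀ j → j ≢ i → t j ≡ false) → ⨁ t ≡ t i
⨁-single t zero    z =
  trans (cong (t zero xor_) (⨁-zero (λ j → z (suc j) (λ ())))) (Bool.xor-identityʳ (t zero))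
⨁-single t (suc i) z =
  cong₂ _xor_ (z zero (λ ())) (⨁-single (t ∘ suc) i (λ j j≢i → z (suc j) (j≢i ∘ Fin.suc-injective)))

odd : ℕ → Bool
odd zero    = false
odd (suc m) = not (odd m)

odd-+ : ∀ a b → odd (a + b) ≡ odd a xor odd b
odd-+ zero    b = refl
odd-+ (suc a) b = trans (cong not (odd-+ a b)) (Bool.not-distribˡ-xor (odd a) (odd b))

-- If both sides have the colour, `m` is even, and being positive it is at least 2.
sides≤multiplicity : ∀ a b m → a xor b ≡ odd m → 1 ≤ m → bit a + bit b ≤ m
sides≤multiplicity false false m             eq le = z≤n
sides≤multiplicity false true  m             eq le = le
sides≤multiplicity true  false m             eq le = le
sides≤multiplicity true  true  (suc (suc m)) eq le = s≤s (s≤s z≤n)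

-- Here `m` may be 0. One coloured side still forces `m` to be odd, so only an edge with both sides
-- coloured can exceed `m`, by at most 2.
sides≤multiplicity+inner : ∀ a b m → a xor b ≡ odd m → bit a + bit b ≤ m + 2 * bit (a ∧ b)
sides≤multiplicity+inner true  true  m       eq = m≤n+m 2 m
sides≤multiplicity+inner true  false (suc m) eq = s≤s z≤n
sides≤multiplicity+inner false true  (suc m) eq = s≤s z≤n
sides≤multiplicity+inner false false m       eq = z≤n

-- Even edge sets and parities of walks.

module Forest {D n : ℕ} (α : Fin D → Fin D) (α-invol : ∀ d → α (α d) ≡ d) (vert : Fin D → Fin n) where

  open Darts α α-invol
  open Growth vert

  -- The degree modulo 2. If `h` is invariant under `α`, it is an edge set, and it belongs to the
  -- cycle space when this vanishes at all vertices.
  degree : (Fin D → Bool) → Fin n → Bool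
  degree h u = ⨁ (λ d → ⌊ vert d Fin.≟ u ⌋ ∧ h d)

  degree-xor : ∀ h k u → degree (λ d → h d xor k d) u ≡ degree h u xor degree k u
  degree-xor h k u = trans
    (sum-cong-≗ (λ d → Bool.∧-distribˡ-xor ⌊ vert d Fin.≟ u ⌋ (h d) (k d)))
    (⨁-distrib-xor (λ d → ⌊ vert d Fin.≟ u ⌋ ∧ h d) (λ d → ⌊ vert d Fin.≟ u ⌋ ∧ k d))

  -- At a leaf, evenness forces h to vanish on the only edge; peel it off.
  forest-even⇒empty : ∀ {vs ds} → Grown vs ds → (h : Fin D → Bool) →
    (∀ d → h (α d) ≡ h d) → (∀ u → degree h u ≡ false) →
    (∀ d → d ∉ darts ds → h d ≡ false) → ∀ d → h d ≡ false
  forest-even⇒empty (root v) h sym-h even off d = off d λ ()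
  forest-even⇒empty (grow {vs} {ds} e g e∈ e∉) h sym-h even off =
    forest-even⇒empty g h sym-h even off′
    where
    -- `α e` is the only tree dart at the new leaf: `e` and all earlier tree darts sit at old
    -- vertices.
    on-leaf : ∀ d → d ≢ α e → ⌊ vert d Fin.≟ vert (α e) ⌋ ∧ h d ≡ false
    on-leaf d d≢ with vert d Fin.≟ vert (α e)
    ... | no  _  = refl
    ... | yes eq = off d λ where
      (here refl)         → e∉ (subst (_∈ vs) eq e∈)
      (there (here d≡))   → d≢ d≡
      (there (there d∈))  → e∉ (subst (_∈ vs) eq (Grown-ends g d∈))
    at-leaf : ⌊ vert (α e) Fin.≟ vert (α e) ⌋ ∧ h (α e) ≡ h (α e)
    at-leaf with vert (α e) Fin.≟ vert (α e)
    ... | yes _  = refl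
    ... | no  ne = contradiction refl ne
    hαe : h (α e) ≡ false
    hαe = trans (sym at-leaf) (trans (sym (⨁-single _ (α e) on-leaf)) (even (vert (α e))))
    off′ : ∀ d → d ∉ darts ds → h d ≡ false
    off′ d d∉ with d Fin.≟ e | d Fin.≟ α e
    ... | yes refl | _        = trans (sym (sym-h e)) hαe
    ... | _        | yes refl = hαe
    ... | no  d≢e  | no d≢αe  = off d λ where
      (here eq)          → d≢e eq
      (there (here eq))  → d≢αe eq
      (there (there d∈)) → d∉ d∈

  data Path : Fin n → Fin n → List (Fin D) → Set where
    []  : ∀ {x} → Path x x []
    _∷_ : ∀ {y ds} d → Path (vert (α d)) y ds → Path (vert d) y (d ∷ ds)

  -- Darts record which edges are walked. For a closed walk, the closing step makes the number of
  -- darts equal to the number of counted occurrences of vertices.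
  Linked⇒Path : ∀ x zs y → Linked (λ u v → ∃ λ d → vert d ≡ u × vert (α d) ≡ v) (x ∷ zs ++ [ y ]) →
    ∃ λ ds → Path x y ds × length ds ≡ suc (length zs) ×
      (∀ {u} → u ∈ x ∷ zs → ∃ λ d → d ∈ ds × vert d ≡ u)
  Linked⇒Path x [] y ((d , refl , refl) ∷ _) =
    d ∷ [] , d ∷ [] , refl , λ where (here refl) → d , here refl , refl
  Linked⇒Path x (z ∷ zs) y ((d , refl , refl) ∷ l) with ds , p , len , cover ← Linked⇒Path z zs y l =
    d ∷ ds , d ∷ p , cong suc len , λ where
      (here refl) → d , here refl , refl
      (there u∈)  → let e , e∈ , eq = cover u∈ in e , there e∈ , eq

  open import Data.List.Membership.DecPropositional (Fin._≟_ {n}) using (_∈?_)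

  -- The edges along which a walk first enters its vertices form a tree.
  firstVisits : ∀ {x y ws vs ds} → Path x y ws → Grown vs ds → x ∈ vs →
    ∃ λ vs′ → ∃ λ ds′ → Grown vs′ ds′ × (∀ {v} → v ∈ vs → v ∈ vs′) ×
      (∀ {w} → w ∈ ws → vert w ∈ vs′) × (∀ {d} → d ∈ ds′ → d ∈ ds ⊎ d ∈ ws)
  firstVisits {vs = vs} {ds} [] g x∈ = vs , ds , g , id , (λ ()) , inj₁
  firstVisits {vs = vs} (d ∷ p) g x∈ with vert (α d) ∈? vs
  ... | yes αd∈ with vs′ , ds′ , g′ , sub , cover , from ← firstVisits p g αd∈ =
    vs′ , ds′ , g′ , sub ,
    (λ where (here refl) → sub x∈
             (there w∈)  → cover w∈) ,
    λ d∈ → case-from (from d∈)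
    where
    case-from : ∀ {e ds ws} → e ∈ ds ⊎ e ∈ ws → e ∈ ds ⊎ e ∈ d ∷ ws
    case-from (inj₁ e∈) = inj₁ e∈
    case-from (inj₂ e∈) = inj₂ (there e∈)
  ... | no αd∉ with vs′ , ds′ , g′ , sub , cover , from ← firstVisits p (grow d g x∈ αd∉) (here refl) =
    vs′ , ds′ , g′ , sub ∘ there ,
    (λ where (here refl) → sub (there x∈)
             (there w∈)  → cover w∈) ,
    λ d∈ → case-from (from d∈)
    where
    case-from : ∀ {e ds ws} → e ∈ d ∷ ds ⊎ e ∈ ws → e ∈ ds ⊎ e ∈ d ∷ ws
    case-from (inj₁ (here eq))  = inj₂ (here eq)
    case-from (inj₁ (there e∈)) = inj₁ e∈
    case-from (inj₂ e∈)         = inj₂ (there e∈)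

  count : List (Fin D) → Fin D → ℕ
  count ws d = length (filterᵇ (λ w → ⌊ d Fin.≟ w ⌋) ws)

  multiplicity : List (Fin D) → Fin D → ℕ
  multiplicity ws d = count ws d + count ws (α d)

  odd-count : ∀ w ws d → odd (count (w ∷ ws) d) ≡ ⌊ d Fin.≟ w ⌋ xor odd (count ws d)
  odd-count w ws d with d Fin.≟ w
  ... | yes _ = refl
  ... | no  _ = refl

  parity : List (Fin D) → Fin D → Bool
  parity ws d = odd (multiplicity ws d)

  parity-α : ∀ ws d → parity ws (α d) ≡ parity ws d
  parity-α ws d = cong odd (trans (cong (λ e → count ws (α d) + count ws e) (α-invol d))
                                  (+-comm (count ws (α d)) (count ws d)))

  parity-∷ : ∀ w ws d → parity (w ∷ ws) d ≡ (⌊ d Fin.≟ w ⌋ xor ⌊ α d Fin.≟ w ⌋) xor parity ws d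
  parity-∷ w ws d = begin
    odd (count (w ∷ ws) d + count (w ∷ ws) (α d))
      ≡⟨ odd-+ (count (w ∷ ws) d) _ ⟩
    odd (count (w ∷ ws) d) xor odd (count (w ∷ ws) (α d))
      ≡⟨ cong₂ _xor_ (odd-count w ws d) (odd-count w ws (α d)) ⟩
    (⌊ d Fin.≟ w ⌋ xor odd (count ws d)) xor (⌊ α d Fin.≟ w ⌋ xor odd (count ws (α d)))
      ≡⟨ interchange ⌊ d Fin.≟ w ⌋ (odd (count ws d)) ⌊ α d Fin.≟ w ⌋ _ ⟩
    (⌊ d Fin.≟ w ⌋ xor ⌊ α d Fin.≟ w ⌋) xor (odd (count ws d) xor odd (count ws (α d)))
      ≡⟨ cong ((⌊ d Fin.≟ w ⌋ xor ⌊ α d Fin.≟ w ⌋) xor_) (odd-+ (count ws d) (count ws (α d))) ⟨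
    (⌊ d Fin.≟ w ⌋ xor ⌊ α d Fin.≟ w ⌋) xor parity ws d ∎
    where
    open ≡-Reasoning
    open import Algebra.Properties.CommutativeSemigroup
      (CommutativeRing.+-commutativeSemigroup Bool.xor-∧-commutativeRing) using (interchange)

  degree-cong : ∀ {h k} → (∀ d → h d ≡ k d) → ∀ u → degree h u ≡ degree k u
  degree-cong eq u = sum-cong-≗ (λ d → cong (⌊ vert d Fin.≟ u ⌋ ∧_) (eq d))

  degree-single : ∀ (h : Fin D → Bool) w u → h w ≡ true → (∀ d → h d ≡ true → d ≡ w) →
    degree h u ≡ ⌊ vert w Fin.≟ u ⌋
  degree-single h w u hw only = trans (⨁-single _ w off)
    (trans (cong (⌊ vert w Fin.≟ u ⌋ ∧_) hw) (Bool.∧-identityʳ _))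
    where
    off : ∀ d → d ≢ w → ⌊ vert d Fin.≟ u ⌋ ∧ h d ≡ false
    off d d≢w with h d in eq
    ... | true  = contradiction (only d eq) d≢w
    ... | false = Bool.∧-zeroʳ _

  degree-dart : ∀ w u → degree (λ d → ⌊ d Fin.≟ w ⌋) u ≡ ⌊ vert w Fin.≟ u ⌋
  degree-dart w u = degree-single _ w u (Equivalence.to Bool.T-≡ (fromWitness {a? = w Fin.≟ w} refl))
    (λ d eq → toWitness {a? = d Fin.≟ w} (Equivalence.from Bool.T-≡ eq))

  degree-αdart : ∀ w u → degree (λ d → ⌊ α d Fin.≟ w ⌋) u ≡ ⌊ vert (α w) Fin.≟ u ⌋
  degree-αdart w u = degree-single _ (α w) u
    (Equivalence.to Bool.T-≡ (fromWitness {a? = α (α w) Fin.≟ w} (α-invol w)))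
    (λ d eq → trans (sym (α-invol d))
                    (cong α (toWitness {a? = α d Fin.≟ w} (Equivalence.from Bool.T-≡ eq))))

  -- Each step flips the parity at its two ends; along the walk the flips telescope to the first and
  -- last vertex.
  degree-parity : ∀ {x y ws} → Path x y ws → ∀ u →
    degree (parity ws) u ≡ ⌊ x Fin.≟ u ⌋ xor ⌊ y Fin.≟ u ⌋
  degree-parity {x} [] u =
    trans (⨁-zero (λ d → Bool.∧-zeroʳ ⌊ vert d Fin.≟ u ⌋)) (sym (Bool.xor-same ⌊ x Fin.≟ u ⌋))
  degree-parity {y = y} (_∷_ {ds = ws} w p) u = begin
    degree (parity (w ∷ ws)) u
      ≡⟨ degree-cong (parity-∷ w ws) u ⟩
    degree (λ d → (⌊ d Fin.≟ w ⌋ xor ⌊ α d Fin.≟ w ⌋) xor parity ws d) u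
      ≡⟨ degree-xor (λ d → ⌊ d Fin.≟ w ⌋ xor ⌊ α d Fin.≟ w ⌋) (parity ws) u ⟩
    degree (λ d → ⌊ d Fin.≟ w ⌋ xor ⌊ α d Fin.≟ w ⌋) u xor degree (parity ws) u
      ≡⟨ cong₂ _xor_ (trans (degree-xor (λ d → ⌊ d Fin.≟ w ⌋) (λ d → ⌊ α d Fin.≟ w ⌋) u)
                            (cong₂ _xor_ (degree-dart w u) (degree-αdart w u)))
                     (degree-parity p u) ⟩
    (⌊ vert w Fin.≟ u ⌋ xor ⌊ vert (α w) Fin.≟ u ⌋) xor (⌊ vert (α w) Fin.≟ u ⌋ xor ⌊ y Fin.≟ u ⌋)
      ≡⟨ telescope ⌊ vert w Fin.≟ u ⌋ ⌊ vert (α w) Fin.≟ u ⌋ ⌊ y Fin.≟ u ⌋ ⟩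
    ⌊ vert w Fin.≟ u ⌋ xor ⌊ y Fin.≟ u ⌋ ∎
    where
    open ≡-Reasoning
    telescope : ∀ a b c → (a xor b) xor (b xor c) ≡ a xor c
    telescope a b c = trans (Bool.xor-assoc a b (b xor c)) (cong (a xor_)
      (trans (sym (Bool.xor-assoc b b c)) (cong (_xor c) (Bool.xor-same b))))

  closed-parity-even : ∀ {x ws} → Path x x ws → ∀ u → degree (parity ws) u ≡ false
  closed-parity-even {x} p u = trans (degree-parity p u) (Bool.xor-same ⌊ x Fin.≟ u ⌋)

  1≤multiplicity : ∀ {ws d} → d ∈ ws → 1 ≤ multiplicity ws d
  1≤multiplicity {ws} {d} d∈ = ≤-trans
    (nonempty (∈-filter⁺ (λ w → Bool.T? ⌊ d Fin.≟ w ⌋) d∈ (fromWitness refl))) (m≤m+n (count ws d) _)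
    where
    nonempty : ∀ {xs : List (Fin D)} → d ∈ xs → 1 ≤ length xs
    nonempty (here _)  = s≤s z≤n
    nonempty (there _) = s≤s z≤n

-- Tree and cotree of a plane graph.

module Plane (G : PlaneGraph) where

  open PlaneGraph G

  D : ℕ
  D = nE + nE

  φ : Fin D → Fin D
  φ d = σ (α d)

  φ-injective : ∀ {x y} → φ x ≡ φ y → x ≡ y
  φ-injective {x} {y} eq = begin
    x             ≡⟨ α-invol x ⟨
    α (α x)       ≡⟨ cong α (σ⁻-σ (α x)) ⟨
    α (σ⁻ (φ x))  ≡⟨ cong (α ∘ σ⁻) eq ⟩
    α (σ⁻ (φ y))  ≡⟨ cong α (σ⁻-σ (α y)) ⟩
    α (α y)       ≡⟨ α-invol y ⟩
    y             ∎
    where open ≡-Reasoning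

  open Orbits φ φ-injective public
  open Darts α α-invol public
  open Forest α α-invol vert public
  module Primal = Growth vert
  -- The dual graph has the same darts and the same `α`; a dart is attached to its face instead of
  -- its vertex.
  module Dual = Growth rep

  -- `φ d` sits at the vertex of `α d`, so a fixed dart would belong to a loop. Hence faces have
  -- length at least 2.
  φ-nofix : ∀ d → φ d ≢ d
  φ-nofix d eq = noLoop d (trans (sym (vert-σ (α d))) (cong vert eq))

  -- `σ d` is `φ (α d)`, the dart that follows `α d` on its face.
  face-invariant : (a : Fin D → Bool) → ∀ d → a (rep (α d)) ≡ a (rep (σ d))
  face-invariant a d = cong a (trans (sym (rep-step (α d))) (cong (rep ∘ σ) (α-invol d)))

  -- Around a vertex, the faces to the left of α d and σ d coincide, so the colour changes cancel.
  boundary-even : (a : Fin D → Bool) → ∀ u → degree (λ d → a (rep d) xor a (rep (α d))) u ≡ false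
  boundary-even a u = begin
    degree (λ d → a (rep d) xor a (rep (α d))) u
      ≡⟨ degree-xor (a ∘ rep) (a ∘ rep ∘ α) u ⟩
    degree (a ∘ rep) u xor degree (a ∘ rep ∘ α) u
      ≡⟨ cong (degree (a ∘ rep) u xor_)
           (trans (sum-cong-≗ rotate) (sym (sum-permute at-u σ-permutation))) ⟩
    degree (a ∘ rep) u xor degree (a ∘ rep) u
      ≡⟨ Bool.xor-same (degree (a ∘ rep) u) ⟩
    false ∎
    where
    open ≡-Reasoning
    σ-permutation : Permutation′ D
    σ-permutation = permutation σ σ⁻ σ-σ⁻ σ⁻-σ
    at-u : Fin D → Bool
    at-u d = ⌊ vert d Fin.≟ u ⌋ ∧ a (rep d)
    rotate : ∀ d → ⌊ vert d Fin.≟ u ⌋ ∧ a (rep (α d)) ≡ at-u (σ d)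
    rotate d = cong₂ _∧_ (cong (λ v → ⌊ v Fin.≟ u ⌋) (sym (vert-σ d))) (face-invariant a d)

  -- An `α`-step crosses an edge, and a `σ`-step from `d` leads to the face of `α d`, so it amounts
  -- to the same crossing.
  connected-constant : (a : Fin D → Bool) → (∀ d → a (rep (α d)) ≡ a (rep d)) →
    ∀ x y → a (rep x) ≡ a (rep y)
  connected-constant a inv x y = go (connected x y)
    where
    go : ∀ {x y} → MapReach σ α x y → a (rep x) ≡ a (rep y)
    go here              = refl
    go (stepσ {d} reach) = trans (trans (sym (inv d)) (face-invariant a d)) (go reach)
    go (stepα {d} reach) = trans (sym (inv d)) (go reach)

  module WithTree {vs ts} (tree : Primal.Grown vs ts) (vs-full : ∀ v → v ∈ vs) where

    Avoids : List (Fin D) → Set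
    Avoids ds = ∀ {d} → d ∈ ds → d ∉ darts ts

    open import Data.List.Membership.DecPropositional (Fin._≟_ {D}) using (_∈?_)

    -- If no edge outside the tree leaves `fs`, the colour changes of its indicator form an even set
    -- inside the tree, so there are none. By connectivity the indicator is constant, and
    -- `rep x ∈ fs` makes it true.
    cotree-step : ∀ {fs} x → rep x ∈ fs →
      (∀ d → rep d ∈ fs) ⊎ ∃ λ d → d ∉ darts ts × rep d ∈ fs × rep (α d) ∉ fs
    cotree-step {fs} x x∈
      with Fin.any? (λ d → ¬? (d ∈? darts ts) ×-dec (rep d ∈? fs) ×-dec ¬? (rep (α d) ∈? fs))
    ... | yes found = inj₂ found
    ... | no  stuck = inj₁ λ d → toWitness {a? = rep d ∈? fs}
                        (subst T (connected-constant a inv x d) (fromWitness x∈))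
      where
      -- A stuck set of faces is bounded by tree edges only.
      a : Fin D → Bool
      a f = ⌊ f ∈? fs ⌋
      off : ∀ d → d ∉ darts ts → a (rep d) xor a (rep (α d)) ≡ false
      off d d∉ with rep d ∈? fs | rep (α d) ∈? fs
      ... | yes _  | yes _   = refl
      ... | no  _  | no  _   = refl
      ... | yes d∈ | no  αd∉ = contradiction (d , d∉ , d∈ , αd∉) stuck
      ... | no d∉′ | yes αd∈ = contradiction
        (α d , d∉ ∘ darts-α⁻ , αd∈ , subst (λ e → rep e ∉ fs) (sym (α-invol d)) d∉′) stuck
      inv : ∀ d → a (rep (α d)) ≡ a (rep d)
      inv d = xor-false (forest-even⇒empty tree (λ d → a (rep d) xor a (rep (α d)))
        (λ d → trans (cong (λ e → a (rep (α d)) xor a (rep e)) (α-invol d))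
                     (Bool.xor-comm (a (rep (α d))) (a (rep d))))
        (boundary-even a) off d)

    record Cotree : Set where
      field
        {fs ss} : List (Fin D)
        grown   : Dual.Grown fs ss
        avoids  : Avoids ss
        fs⊆reps : ∀ {f} → f ∈ fs → f ∈ reps
        fs-full : ∀ d → rep d ∈ fs

    -- `fs` has no duplicates, so its length is at most `D` and the fuel cannot run out before all
    -- faces are reached.
    cotree-from : ∀ fuel {fs ss} → D < fuel + length fs → Dual.Grown fs ss → Avoids ss →
      (∀ {f} → f ∈ fs → f ∈ reps) → ∀ x → rep x ∈ fs → Cotree
    cotree-from zero       lt g _ _ _ _ = contradiction (unique⇒length≤ (Dual.Grown-unique g)) (<⇒≱ lt)
    cotree-from (suc fuel) {fs} lt g av sub x x∈ with cotree-step x x∈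
    ... | inj₁ full = record { grown = g ; avoids = av ; fs⊆reps = sub ; fs-full = full }
    ... | inj₂ (d , d∉ , d∈ , αd∉) =
      cotree-from fuel (subst (D <_) (sym (+-suc fuel (length fs))) lt) (Dual.grow d g d∈ αd∉)
        (λ where (here refl) → d∉
                 (there e∈)  → av e∈)
        (λ where (here refl) → rep∈reps (α d)
                 (there f∈)  → sub f∈)
        x (there x∈)

    cotree : Fin D → Cotree
    cotree x = cotree-from D (≤-reflexive (sym (+-comm D 1))) (Dual.root (rep x)) (λ ())
      (λ where (here refl) → rep∈reps x) x (here refl)

    length-ts : suc (length ts) ≡ n
    length-ts = begin
      suc (length ts)   ≡⟨ Primal.Grown-length tree ⟨
      length vs         ≡⟨ ↭.↭-length (full⇒↭ (Primal.Grown-unique tree) vs-full) ⟩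
      length (allFin n) ≡⟨ length-tabulate id ⟩
      n                 ∎
      where open ≡-Reasoning

    module WithCotree (C : Cotree) where

      open Cotree C

      fs↭reps : fs ↭ reps
      fs↭reps = unique∧set⇒↭ (Dual.Grown-unique grown) reps-unique fs⊆reps
        (λ f∈ → subst (_∈ fs) (∈reps⇒rep≡ f∈) (fs-full _))

      -- The two spanning trees have one edge less than there are vertices and faces, respectively;
      -- this accounts for the 2 in Euler's formula.
      length-ts+ss : length ts + length ss ≡ nE
      length-ts+ss = +-cancelˡ-≡ 2 _ _ (begin
        2 + (length ts + length ss)         ≡⟨ cong suc (+-suc (length ts) (length ss)) ⟨
        suc (length ts) + suc (length ss)   ≡⟨ cong₂ _+_ length-ts (sym (Dual.Grown-length grown)) ⟩
        n + length fs                       ≡⟨ cong (n +_) (↭.↭-length fs↭reps) ⟩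
        n + length reps                     ≡⟨ cong (n +_) (length-map (orbitSize φ) reps) ⟨
        n + length (orbitSizes φ)           ≡⟨ euler ⟩
        2 + nE                              ∎)
        where open ≡-Reasoning

      edges : List (Fin D)
      edges = ts ++ ss

      disjoint : ∀ {d} → d ∈ darts ss → d ∉ darts ts
      disjoint d∈ss d∈ts with ∈darts⇒ d∈ss
      ... | inj₁ d∈  = avoids d∈ d∈ts
      ... | inj₂ αd∈ = avoids αd∈ (darts-α d∈ts)

      darts-edges-unique : Unique (darts edges)
      darts-edges-unique = subst Unique (sym (darts-++ ts))
        (Unique.++⁺ (Primal.Grown-darts-unique tree) (Dual.Grown-darts-unique grown)
          (λ (d∈ts , d∈ss) → disjoint d∈ss d∈ts))

      -- Euler's formula makes the edges of tree and cotree as many as all edges.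
      darts-edges-full : ∀ d → d ∈ darts edges
      darts-edges-full = unique⇒full darts-edges-unique (≤-reflexive (begin
        nE + nE                         ≡⟨ cong (nE +_) (+-identityʳ nE) ⟨
        2 * nE                          ≡⟨ cong (2 *_) length-ts+ss ⟨
        2 * (length ts + length ss)     ≡⟨ cong (2 *_) (length-++ ts) ⟨
        2 * length edges                ≡⟨ length-darts edges ⟨
        length (darts edges)            ∎))
        where open ≡-Reasoning

      ∑-edges : ∀ f → ∑ (allFin D) f ≡ ∑ ts (λ d → f d + f (α d)) + ∑ ss (λ d → f d + f (α d))
      ∑-edges f = begin
        ∑ (allFin D) f                ≡⟨ ∑-↭ f (full⇒↭ darts-edges-unique darts-edges-full) ⟨
        ∑ (darts edges) f             ≡⟨ ∑-darts f edges ⟩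
        ∑ edges (λ d → f d + f (α d)) ≡⟨ ∑-++ (λ d → f d + f (α d)) ts ⟩
        ∑ ts (λ d → f d + f (α d)) + ∑ ss (λ d → f d + f (α d)) ∎
        where open ≡-Reasoning

      -- Colouring the faces along a closed walk.

      module WithWalk {x ws} (walk : Path x x ws) (ts⊆ws : ∀ {d} → d ∈ ts → d ∈ ws) where

        length-walk : length ws ≡ ∑ ts (multiplicity ws) + ∑ ss (multiplicity ws)
        length-walk = trans (sym (∑-count ws)) (∑-edges (count ws))

        Colouring : (Fin D → Bool) → Set
        Colouring P = ∀ d → P (rep d) xor P (rep (α d)) ≡ parity ws d

        colouring : ∃ Colouring
        colouring with c , cp ← Dual.Grown-potential Fin._≟_ grown (parity ws) =
          c , λ d → xor-false (forest-even⇒empty tree h sym-h even off d)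
          where
          -- `h` marks the edges where the colouring from the cotree fails. It is the sum of two
          -- even sets and vanishes on the cotree.
          h : Fin D → Bool
          h d = parity ws d xor (c (rep d) xor c (rep (α d)))
          sym-h : ∀ d → h (α d) ≡ h d
          sym-h d = cong₂ _xor_ (parity-α ws d)
            (trans (cong (λ e → c (rep (α d)) xor c (rep e)) (α-invol d))
                   (Bool.xor-comm (c (rep (α d))) (c (rep d))))
          even : ∀ u → degree h u ≡ false
          even u = trans (degree-xor (parity ws) (λ d → c (rep d) xor c (rep (α d))) u)
                         (cong₂ _xor_ (closed-parity-even walk u) (boundary-even c u))
          on-ss : ∀ {d} → d ∈ ss → h d ≡ false
          on-ss {d} d∈ = trans (cong (parity ws d xor_) (cp d∈)) (Bool.xor-same (parity ws d))
          off : ∀ d → d ∉ darts ts → h d ≡ false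
          off d d∉ with ∈-++⁻ (darts ts) (subst (d ∈_) (darts-++ ts) (darts-edges-full d))
          ... | inj₁ d∈ = contradiction d∈ d∉
          ... | inj₂ d∈ with ∈darts⇒ d∈
          ...   | inj₁ d∈ss  = on-ss d∈ss
          ...   | inj₂ αd∈ss = trans (sym (sym-h d)) (on-ss αd∈ss)

        -- This is `A ≤ k + 2(E - 1)` without subtraction: sides are compared with traversals edge
        -- by edge, and the traversals add up to the length of the walk.
        coloured-darts≤ : ∀ P → Colouring P → 1 ≤ ∑ reps (bit ∘ P) →
          ∑ (allFin D) (bit ∘ P ∘ rep) + 2 ≤ length ws + 2 * ∑ reps (bit ∘ P)
        coloured-darts≤ P col pos = begin
          ∑ (allFin D) (bit ∘ P ∘ rep) + 2
            ≡⟨ cong (_+ 2) (∑-edges (bit ∘ P ∘ rep)) ⟩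
          ∑ ts sides + ∑ ss sides + 2
            ≤⟨ +-monoˡ-≤ 2 (+-mono-≤
                 (∑-mono ts (λ {d} d∈ → sides≤multiplicity (P (rep d)) (P (rep (α d)))
                                          (multiplicity ws d) (col d)
                                          (1≤multiplicity (ts⊆ws d∈))))
                 (∑-mono ss (λ {d} _ → sides≤multiplicity+inner (P (rep d)) (P (rep (α d)))
                                          (multiplicity ws d) (col d)))) ⟩
          ∑ ts (multiplicity ws) + ∑ ss (λ d → multiplicity ws d + 2 * inner d) + 2
            ≡⟨ cong (λ s → ∑ ts (multiplicity ws) + s + 2)
                 (trans (∑-distrib-+ (multiplicity ws) (λ d → 2 * inner d) ss)
                        (cong (∑ ss (multiplicity ws) +_) (∑-*ˡ 2 inner ss))) ⟩
          ∑ ts (multiplicity ws) + (∑ ss (multiplicity ws) + 2 * ∑ ss inner) + 2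
            ≡⟨ regroup (∑ ts (multiplicity ws)) (∑ ss (multiplicity ws)) (∑ ss inner) ⟩
          ∑ ts (multiplicity ws) + ∑ ss (multiplicity ws) + 2 * suc (∑ ss inner)
            ≡⟨ cong (_+ 2 * suc (∑ ss inner)) length-walk ⟨
          length ws + 2 * suc (∑ ss inner)
            ≤⟨ +-monoʳ-≤ (length ws) (*-monoʳ-≤ 2 inner<) ⟩
          length ws + 2 * ∑ reps (bit ∘ P) ∎
          where
          open ≤-Reasoning
          sides inner : Fin D → ℕ
          sides d = bit (P (rep d)) + bit (P (rep (α d)))
          inner d = bit (P (rep d) ∧ P (rep (α d)))
          regroup : ∀ a b c → a + (b + 2 * c) + 2 ≡ a + b + 2 * suc c
          regroup = solve-∀
          suc-pred′ : ∀ {m} → 1 ≤ m → suc (pred m) ≡ m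
          suc-pred′ (s≤s _) = refl
          -- The cotree edges inside the class form a forest on its faces. As the class is nonempty,
          -- the bound with `pred` is strict.
          inner< : suc (∑ ss inner) ≤ ∑ reps (bit ∘ P)
          inner< = ≤-trans
            (s≤s (subst (λ m → ∑ ss inner ≤ pred m) (∑-↭ (bit ∘ P) fs↭reps)
                        (Dual.Grown-inner-edges grown P)))
            (≤-reflexive (suc-pred′ pos))

        -- Every tree edge is walked, and an even number of times.
        even-walk-long : (∀ d → parity ws d ≡ false) → 2 * length ts ≤ length ws
        even-walk-long even = begin
          2 * length ts                 ≡⟨ *-comm 2 (length ts) ⟩
          length ts * 2                 ≡⟨ ∑-const 2 ts ⟨
          ∑ ts (λ _ → 2)                ≤⟨ ∑-mono ts (λ {d} d∈ →
                                               twice (even d) (1≤multiplicity (ts⊆ws d∈))) ⟩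
          ∑ ts (multiplicity ws)        ≤⟨ m≤m+n _ _ ⟩
          ∑ ts (multiplicity ws) + ∑ ss (multiplicity ws) ≡⟨ length-walk ⟨
          length ws                     ∎
          where
          open ≤-Reasoning
          twice : ∀ {m} → odd m ≡ false → 1 ≤ m → 2 ≤ m
          twice {suc (suc _)} _ _ = s≤s (s≤s z≤n)

-- Signed sums and the Grinberg number.

module _ where

  open import Data.Integer using (+_)

  -- If the entries of xs sum to A over P and to B over its complement, which have E and F elements,
  -- the signed sum is (A - 2E) - (B - 2F), with both sides moved so that no subtraction occurs.
  signedSum-split : ∀ {A : Set} (P : A → Bool) (s : A → ℕ) xs →
    signedSum (map P xs) (map (λ l → + l ℤ.- + 2) (map s xs)) ℤ.+
      (+ (∑ xs (λ x → bit (not (P x)) * s x) + (∑ xs (bit ∘ P) + ∑ xs (bit ∘ P))))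
    ≡ + (∑ xs (λ x → bit (P x) * s x) + (∑ xs (bit ∘ not ∘ P) + ∑ xs (bit ∘ not ∘ P)))
  signedSum-split P s []       = refl
  signedSum-split P s (x ∷ xs)
    with P x | signedSum (map P xs) (map (λ l → + l ℤ.- + 2) (map s xs)) | signedSum-split P s xs
  ... | true  | S | ih = trans
    (gain (+ s x) S (+ ∑ xs (λ x → bit (not (P x)) * s x)) (+ ∑ xs (bit ∘ P)))
    (trans (cong (λ i → + s x ℤ.+ i) ih)
      (cong (λ k → + k) (regroup (s x) (∑ xs (λ x → bit (P x) * s x)) (∑ xs (bit ∘ not ∘ P)))))
    where
    gain : ∀ s S B E → (s ℤ.- + 2 ℤ.+ S) ℤ.+ (B ℤ.+ ((+ 1 ℤ.+ E) ℤ.+ (+ 1 ℤ.+ E))) ≡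
           s ℤ.+ (S ℤ.+ (B ℤ.+ (E ℤ.+ E)))
    gain = ℤ-Solver.solve-∀
    regroup : ∀ s A F → s + (A + (F + F)) ≡ s + 0 + A + (F + F)
    regroup = solve-∀
  ... | false | S | ih = trans
    (gain (+ s x) S (+ ∑ xs (λ x → bit (not (P x)) * s x)) (+ ∑ xs (bit ∘ P)))
    (trans (cong (λ i → + 2 ℤ.+ i) ih)
      (cong (λ k → + k) (regroup (∑ xs (λ x → bit (P x) * s x)) (∑ xs (bit ∘ not ∘ P)))))
    where
    gain : ∀ s S B E → (ℤ.- (s ℤ.- + 2) ℤ.+ S) ℤ.+ (((s ℤ.+ + 0) ℤ.+ B) ℤ.+ (E ℤ.+ E)) ≡
           + 2 ℤ.+ (S ℤ.+ (B ℤ.+ (E ℤ.+ E)))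
    gain = ℤ-Solver.solve-∀
    regroup : ∀ A F → 2 + (A + (F + F)) ≡ A + (suc F + suc F)
    regroup = solve-∀

  ∣difference∣≤ : ∀ {m} i a b → i ℤ.+ + b ≡ + a → a ≤ b + m → b ≤ a + m → ∣ i ∣ ≤ m
  ∣difference∣≤ {m} (+ k) a b eq a≤ _ = +-cancelʳ-≤ b k m (begin
    k + b ≡⟨ ℤ.+-injective eq ⟩
    a     ≤⟨ a≤ ⟩
    b + m ≡⟨ +-comm b m ⟩
    m + b ∎)
    where open ≤-Reasoning
  ∣difference∣≤ {m} i@(ℤ.-[1+ k ]) a b eq _ b≤ = +-cancelˡ-≤ a (suc k) m (begin
    a + suc k ≡⟨ ℤ.+-injective a+k≡b ⟩
    b         ≤⟨ b≤ ⟩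
    a + m     ∎)
    where
    open ≤-Reasoning
    cancel : ∀ i b → i ℤ.+ b ℤ.- i ≡ b
    cancel = ℤ-Solver.solve-∀
    a+k≡b : + a ℤ.+ + suc k ≡ + b
    a+k≡b = trans (cong (λ i → i ℤ.+ + suc k) (sym eq)) (cancel i (+ b))

∈signVecs : ∀ es → es ∈ signVecs (length es)
∈signVecs []           = here refl
∈signVecs (true  ∷ es) =
  ∈-concatMap⁺ (λ v → (true ∷ v) ∷ (false ∷ v) ∷ []) (lose (∈signVecs es) (here refl))
∈signVecs (false ∷ es) =
  ∈-concatMap⁺ (λ v → (true ∷ v) ∷ (false ∷ v) ∷ []) (lose (∈signVecs es) (there (here refl)))

minList≤ : ∀ {x} xs → x ∈ xs → minList xs ≤ x
minList≤ (x ∷ xs) = go xs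
  where
  -- The head `x` is the seed of the fold, so it stays in place while `ys` shrinks.
  go : ∀ {y} ys → y ∈ x ∷ ys → foldr _⊓_ x ys ≤ y
  go []       (here refl)         = ≤-refl
  go (y ∷ ys) (here refl)         = ≤-trans (m⊓n≤n y _) (go ys (here refl))
  go (y ∷ ys) (there (here refl)) = m⊓n≤m y _
  go (y ∷ ys) (there (there z∈))  = ≤-trans (m⊓n≤n y _) (go ys (there z∈))

-- The sign is plus on `P` and minus elsewhere; `x` and `y` witness that both signs occur, so the
-- vector is not one of the two excluded.
grinbergNumber≤ : ∀ {A : Set} (P : A → Bool) (s : A → ℕ) xs {x y} →
  x ∈ xs → T (P x) → y ∈ xs → T (not (P y)) →
  grinbergNumber (map s xs) ≤ ∣ signedSum (map P xs) (map (λ l → ℤ.+ l ℤ.- ℤ.+ 2) (map s xs)) ∣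
grinbergNumber≤ P s xs {x} {y} x∈ Px y∈ Py =
  minList≤ _ (∈-map⁺ _ (∈-filter⁺ (λ es → Bool.T? (nonConstant es)) in-signVecs nonconstant))
  where
  in-signVecs : map P xs ∈ signVecs (length (map s xs))
  in-signVecs = subst (λ N → map P xs ∈ signVecs N) (trans (length-map P xs) (sym (length-map s xs)))
                      (∈signVecs (map P xs))
  nonconstant : T (nonConstant (map P xs))
  nonconstant = Equivalence.from Bool.T-∧
    ( Any.any⁺ id  (lose (∈-map⁺ P x∈) Px)
    , Any.any⁺ not (lose (∈-map⁺ P y∈) Py))

-- Arithmetic of the two colour classes.

∑-bit-pos : ∀ {A : Set} (P : A → Bool) {xs x} → x ∈ xs → T (P x) → 1 ≤ ∑ xs (bit ∘ P)
∑-bit-pos P {x = x} (here refl) t with P x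
... | true = s≤s z≤n
∑-bit-pos P {y ∷ xs} (there x∈) t = ≤-trans (∑-bit-pos P x∈ t) (m≤n+m _ (bit (P y)))

∑-bit-not : ∀ {A : Set} (P : A → Bool) xs → ∑ xs (bit ∘ P) + ∑ xs (bit ∘ not ∘ P) ≡ length xs
∑-bit-not P xs = trans (sym (∑-distrib-+ (bit ∘ P) (bit ∘ not ∘ P) xs))
  (trans (∑-cong xs (λ {x} _ → one (P x))) (trans (∑-const 1 xs) (*-identityʳ (length xs))))
  where
  one : ∀ b → bit b + bit (not b) ≡ 1
  one true  = refl
  one false = refl

two-distinct : ∀ {A : Set} {xs : List A} → Unique xs → 2 ≤ length xs →
  ∃ λ x → ∃ λ y → x ∈ xs × y ∈ xs × y ≢ x
two-distinct {xs = x ∷ y ∷ _} ((x≢y ∷ _) ∷ _) _ =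
  x , y , here refl , there (here refl) , x≢y ∘ sym
two-distinct {xs = _ ∷ []} _ (s≤s ())

-- From here on A and B count the darts in faces of either colour, E and F the faces, N is the
-- number of vertices, M of edges, K the length of the walk and R its number of repeats.
colour-balance : ∀ {A B N M K} E F R → A + B ≡ M + M → N + (E + F) ≡ 2 + M → K ≤ N + R →
  A + 2 ≤ K + 2 * E → A + (F + F) ≤ B + (E + E) + 2 * R
colour-balance {A} {B} {N} {M} {K} E F R darts euler repeats bound =
  -- Adding `A + 4` makes room for twice `bound`. Euler's formula then replaces `N + (E + F)`, and
  -- `M + M` splits into `A + B`.
  +-cancelʳ-≤ (A + 4) _ _ (begin
    A + (F + F) + (A + 4)                 ≡⟨ e₁ A F ⟩
    2 * (A + 2) + 2 * F                   ≤⟨ +-monoˡ-≤ (2 * F)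
                                               (*-monoʳ-≤ 2 (≤-trans bound (+-monoˡ-≤ (2 * E) repeats))) ⟩
    2 * (N + R + 2 * E) + 2 * F           ≡⟨ e₂ N R E F ⟩
    2 * (N + (E + F)) + 2 * E + 2 * R     ≡⟨ cong (λ m → 2 * m + 2 * E + 2 * R) euler ⟩
    2 * (2 + M) + 2 * E + 2 * R           ≡⟨ e₃ M E R ⟩
    (M + M) + (4 + (E + E) + 2 * R)       ≡⟨ cong (_+ (4 + (E + E) + 2 * R)) darts ⟨
    (A + B) + (4 + (E + E) + 2 * R)       ≡⟨ e₄ A B E R ⟩
    B + (E + E) + 2 * R + (A + 4)         ∎)
  where
  open ≤-Reasoning
  e₁ : ∀ A F → A + (F + F) + (A + 4) ≡ 2 * (A + 2) + 2 * F
  e₁ = solve-∀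
  e₂ : ∀ N R E F → 2 * (N + R + 2 * E) + 2 * F ≡ 2 * (N + (E + F)) + 2 * E + 2 * R
  e₂ = solve-∀
  e₃ : ∀ M E R → 2 * (2 + M) + 2 * E + 2 * R ≡ (M + M) + (4 + (E + E) + 2 * R)
  e₃ = solve-∀
  e₄ : ∀ A B E R → (A + B) + (4 + (E + E) + 2 * R) ≡ B + (E + E) + 2 * R + (A + 4)
  e₄ = solve-∀

-- By Euler's formula `A + B` equals `2(N - 1) + 2E + 2F - 2`. The walk covers `2(N - 1)`, and `B`
-- covers `2F` because faces have length at least 2.
long-walk-bound : ∀ {A B N M K t} E F → A + B ≡ M + M → N + (E + F) ≡ 2 + M → suc t ≡ N →
  2 * t ≤ K → 2 * F ≤ B → A + 2 ≤ K + 2 * E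
long-walk-bound {A} {B} {N} {M} {K} {t} E F darts euler refl long faces =
  +-cancelʳ-≤ (B + 2) _ _ (begin
    A + 2 + (B + 2)               ≡⟨ e₁ A B ⟩
    A + B + 4                     ≡⟨ cong (_+ 4) darts ⟩
    M + M + 4                     ≡⟨ e₂ M ⟩
    2 * (2 + M)                   ≡⟨ cong (2 *_) euler ⟨
    2 * (suc t + (E + F))         ≡⟨ e₃ t E F ⟩
    2 * t + 2 * E + (2 * F + 2)   ≤⟨ +-mono-≤ (+-monoˡ-≤ (2 * E) long) (+-monoˡ-≤ 2 faces) ⟩
    K + 2 * E + (B + 2)           ∎)
  where
  open ≤-Reasoning
  e₁ : ∀ A B → A + 2 + (B + 2) ≡ A + B + 4
  e₁ = solve-∀
  e₂ : ∀ M → M + M + 4 ≡ 2 * (2 + M)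
  e₂ = solve-∀
  e₃ : ∀ t E F → 2 * (suc t + (E + F)) ≡ 2 * t + 2 * E + (2 * F + 2)
  e₃ = solve-∀

-- The occurrences of all vertices add up to the length, and each vertex accounts for at most one
-- occurrence beyond its repeats.
length≤n+repeats : ∀ G w → length w ≤ PlaneGraph.n G + PlaneGraph.repeats G w
length≤n+repeats G w = begin
  length w                                  ≡⟨ ∑-count w ⟨
  ∑ (allFin n) occurrences                  ≤⟨ ∑-mono (allFin n) (λ {u} _ → m≤n+m∸n (occurrences u) 1) ⟩
  ∑ (allFin n) (λ u → 1 + (occurrences u ∸ 1))
                                            ≡⟨ ∑-distrib-+ (λ _ → 1) (λ u → occurrences u ∸ 1) (allFin n) ⟩
  ∑ (allFin n) (λ _ → 1) + repeats w        ≡⟨ cong (_+ repeats w)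
                                                 (trans (∑-const 1 (allFin n)) (*-identityʳ _)) ⟩
  length (allFin n) + repeats w             ≡⟨ cong (_+ repeats w) (length-tabulate id) ⟩
  n + repeats w                             ∎
  where
  open PlaneGraph G using (n; repeats)
  open ≤-Reasoning
  occurrences : Fin n → ℕ
  occurrences u = length (filterᵇ (λ x → ⌊ u Fin.≟ x ⌋) w)

-- The Grinberg bound for closed spanning walks.

module Grinberg (G : PlaneGraph) where

  open PlaneGraph G
  open Plane G

  facesOf dartsOf : (Fin D → Bool) → ℕ
  facesOf P = ∑ reps (bit ∘ P)
  dartsOf P = ∑ (allFin D) (bit ∘ P ∘ rep)

  darts-balance : ∀ P → dartsOf P + dartsOf (not ∘ P) ≡ D
  darts-balance P = trans (∑-bit-not (P ∘ rep) (allFin D)) (length-tabulate id)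

  faces-balance : ∀ P → n + (facesOf P + facesOf (not ∘ P)) ≡ 2 + nE
  faces-balance P = trans
    (cong (n +_) (trans (∑-bit-not P reps) (sym (length-map (orbitSize φ) reps)))) euler

  darts-balance′ : ∀ P → dartsOf (not ∘ P) + dartsOf P ≡ D
  darts-balance′ P = trans (+-comm (dartsOf (not ∘ P)) (dartsOf P)) (darts-balance P)

  faces-balance′ : ∀ P → n + (facesOf (not ∘ P) + facesOf P) ≡ 2 + nE
  faces-balance′ P = trans (cong (n +_) (+-comm (facesOf (not ∘ P)) (facesOf P))) (faces-balance P)

  2*faces≤darts : ∀ P → 2 * facesOf P ≤ dartsOf P
  2*faces≤darts P = begin
    2 * facesOf P
      ≡⟨ ∑-*ˡ 2 (bit ∘ P) reps ⟨
    ∑ reps (λ x → 2 * bit (P x))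
      ≤⟨ ∑-mono reps (λ {x} _ → ≤-trans (≤-reflexive (*-comm 2 (bit (P x))))
                                        (*-monoʳ-≤ (bit (P x)) (2≤orbitSize x (φ-nofix x)))) ⟩
    ∑ reps (λ x → bit (P x) * orbitSize φ x)
      ≡⟨ ∑-orbitSize (bit ∘ P) ⟩
    dartsOf P ∎
    where open ≤-Reasoning

  -- The bound for `P` limits the signed sum from above, the bound for its complement from below.
  grinberg-bound : ∀ P {x y K R} → x ∈ reps → T (P x) → y ∈ reps → T (not (P y)) → K ≤ n + R →
    dartsOf P + 2 ≤ K + 2 * facesOf P → dartsOf (not ∘ P) + 2 ≤ K + 2 * facesOf (not ∘ P) →
    grinbergNumber faceLengths ≤ 2 * R
  grinberg-bound P {K = K} {R} x∈ Px y∈ Py K≤ bound bound′ = ≤-trans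
    (grinbergNumber≤ P (orbitSize φ) reps x∈ Px y∈ Py)
    (∣difference∣≤ total (A + (F + F)) (B + (E + E)) split
      (colour-balance E F R (darts-balance P) (faces-balance P) K≤ bound)
      (colour-balance F E R (darts-balance′ P) (faces-balance′ P) K≤ bound′))
    where
    A B E F : ℕ
    A = dartsOf P
    B = dartsOf (not ∘ P)
    E = facesOf P
    F = facesOf (not ∘ P)
    total : ℤ
    total = signedSum (map P reps) (map (λ l → ℤ.+ l ℤ.- ℤ.+ 2) faceLengths)
    split : total ℤ.+ ℤ.+ (B + (E + E)) ≡ ℤ.+ (A + (F + F))
    split = subst₂ (λ a b → total ℤ.+ ℤ.+ (b + (E + E)) ≡ ℤ.+ (a + (F + F)))
      (∑-orbitSize (bit ∘ P)) (∑-orbitSize (bit ∘ not ∘ P)) (signedSum-split P (orbitSize φ) reps)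

  grinberg-walk : 2 ≤ numFaces → ∀ v vs → IsClosedWalk v vs → (∀ u → u ∈ v ∷ vs) →
    grinbergNumber faceLengths ≤ 2 * repeats (v ∷ vs)
  grinberg-walk 2≤faces v vs closed spanning
    with ws , walk , len , onWalk ← Linked⇒Path v vs v closed
    with tvs , ts , tree , _ , visited , from ← firstVisits walk (Primal.root v) (here refl)
    = conclude
    where
    full : ∀ u → u ∈ tvs
    full u with w , w∈ , refl ← onWalk (spanning u) = visited w∈

    ts⊆ws : ∀ {d} → d ∈ ts → d ∈ ws
    -- The initial tree is a single vertex without edges, so all tree edges come from the walk.
    ts⊆ws d∈ with inj₂ d∈ws ← from d∈ = d∈ws

    open WithTree tree full
    -- `vert-surj` supplies a dart at `v`, whose face becomes the root of the cotree.
    open WithCotree (cotree (proj₁ (vert-surj v)))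
    open WithWalk walk ts⊆ws

    K≤ : length ws ≤ n + repeats (v ∷ vs)
    K≤ = subst (_≤ n + repeats (v ∷ vs)) (sym len) (length≤n+repeats G (v ∷ vs))

    -- If all faces have the same colour, every tree edge is walked at least twice, and the
    -- walk is so long that separating a single face from the others is good enough.
    monochromatic : (∀ d → parity ws d ≡ false) → grinbergNumber faceLengths ≤ 2 * repeats (v ∷ vs)
    monochromatic even
      with x , y , x∈ , y∈ , y≢x ← two-distinct reps-unique
             (subst (2 ≤_) (length-map (orbitSize φ) reps) 2≤faces) =
      grinberg-bound P x∈ (fromWitness refl) y∈ (not-T (λ t → y≢x (toWitness t))) K≤
        (long-walk-bound (facesOf P) (facesOf (not ∘ P)) (darts-balance P) (faces-balance P)
          length-ts long (2*faces≤darts (not ∘ P)))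
        (long-walk-bound (facesOf (not ∘ P)) (facesOf P) (darts-balance′ P) (faces-balance′ P)
          length-ts long (2*faces≤darts P))
      where
      long : 2 * length ts ≤ length ws
      long = even-walk-long even
      P : Fin D → Bool
      P z = ⌊ z Fin.≟ x ⌋

    conclude : grinbergNumber faceLengths ≤ 2 * repeats (v ∷ vs)
    conclude with c , col ← colouring
             with any? (λ x → Bool.T? (c x)) reps | any? (λ x → Bool.T? (not (c x))) reps
    ... | yes p | yes q with x , x∈ , cx ← find p with y , y∈ , cy ← find q =
      grinberg-bound c x∈ cx y∈ cy K≤
        (coloured-darts≤ c col (∑-bit-pos c x∈ cx))
        (coloured-darts≤ (not ∘ c)
          (λ d → trans (Bool.xor-annihilates-not (c (rep d)) (c (rep (α d)))) (col d))
          (∑-bit-pos (not ∘ c) y∈ cy))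
    -- If one colour is missing, no edge separates two colours, so no edge is walked an odd number
    -- of times.
    ... | no ¬p | _ = monochromatic λ d →
      trans (sym (col d)) (cong₂ _xor_ (all-false d) (all-false (α d)))
      where
      all-false : ∀ d → c (rep d) ≡ false
      all-false d = T-iff (λ t → ¬p (lose (rep∈reps d) t)) λ ()
    ... | _ | no ¬q = monochromatic λ d →
      trans (sym (col d)) (cong₂ _xor_ (all-true d) (all-true (α d)))
      where
      all-true : ∀ d → c (rep d) ≡ true
      all-true d = T-iff _ λ _ → T-not-not (λ t → ¬q (lose (rep∈reps d) t))
        where
        T-not-not : ∀ {b} → ¬ T (not b) → T b
        T-not-not {true}  _ = _
        T-not-not {false} f = f _

open PlaneGraph using (n; faceLengths; numFaces; IsClosedWalk; repeats)

theorem1 : (G : PlaneGraph) → 2 ≤ numFaces G →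
    (v : Fin (n G)) (vs : List (Fin (n G))) →
    IsClosedWalk G v vs → (∀ u → u ∈ v ∷ vs) →
    grinbergNumber (faceLengths G) ≤ 2 * repeats G (v ∷ vs)
theorem1 = Grinberg.grinberg-walk
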